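{- For every nonnegative integer $n$, $$pod(n)=\sum_{\substack{j\ge 0\\ j \text{ even}}}(-1)^{j/2}\,pod\!\left(\frac{j}{2}\right)ped(n-j).$$
   Context: $pod(n)$ denotes the number of partitions of the nonnegative integer $n$ in which odd parts are distinct and even parts may be repeated, with $pod(0)=1$. $ped(n)$ denotes the number of partitions of $n$ in which even parts are distinct and odd parts may be repeated, with $ped(0)=1$ and $ped(m)=0$ for $m<0$. -}

module Defs where

open import Data.Empty using (⊥-elim)
open import Data.Integer as ℤ using (ℤ; +_; -[1+_]; 0ℤ)
open import Data.List.Base using (List; []; _∷_; _++_; map; filter; foldr; length; replicate; concatMap; upTo)
open import Data.List.Properties using (∷-injectiveʳ; ++-cancelˡ)
open import Data.List.Membership.Propositional using (_∈_)
open import Data.List.Membership.Propositional.Properties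
  using (∈-map⁺; ∈-map⁻; ∈-concat⁺′; ∈-concat⁻′; ∈-upTo⁺; ∈-upTo⁻)
open import Data.List.Relation.Binary.Disjoint.Propositional using (Disjoint)
open import Data.List.Relation.Unary.All as All using (All; []; _∷_)
import Data.List.Relation.Unary.All.Properties as All
open import Data.List.Relation.Unary.AllPairs as AllPairs using (AllPairs; []; _∷_)
import Data.List.Relation.Unary.AllPairs.Properties as AllPairs
open import Data.List.Relation.Unary.Any using (here)
open import Data.List.Relation.Unary.Linked using (Linked)
open import Data.List.Relation.Unary.Linked.Properties using (AllPairs⇒Linked; Linked⇒AllPairs)
open import Data.List.Relation.Unary.Unique.Propositional using (Unique)
import Data.List.Relation.Unary.Unique.Propositional.Properties as Unique
open import Data.Nat
open import Data.Nat.DivMod using (_/_; m/n*n≤m; m*n/n≡m; /-monoˡ-≤)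
open import Data.Nat.Divisibility using (_∣_; _∣?_)
open import Data.Nat.ListAction using (sum)
open import Data.Nat.ListAction.Properties using (sum-++)
open import Data.Nat.Properties
open import Data.List.Relation.Unary.Unique.DecPropositional _≟_ using (unique?)
open import Data.Product using (_×_; _,_; ∃-syntax)
open import Level using (Level)
open import Relation.Binary.PropositionalEquality
open import Relation.Nullary using (¬_; yes; no; ¬?)
open import Relation.Unary using (Pred; Decidable)

private
  variable
    p : Level

Even Odd : Pred ℕ _
Even m = 2 ∣ m
Odd m = ¬ Even m

even? : Decidable Even
even? m = 2 ∣? m

odd? : Decidable Odd
odd? m = ¬? (even? m)

record _PartitionOf_ (xs : List ℕ) (n : ℕ) : Set where
  field
    nonincreasing : Linked _≥_ xs
    positive      : All (0 <_) xs
    total         : sum xs ≡ n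

-- The partitions of n with all parts ≤ k; m is the multiplicity of the part
-- suc k.
partitions≤ : (k n : ℕ) → List (List ℕ)
partitions≤ zero    zero    = [] ∷ []
partitions≤ zero    (suc _) = []
partitions≤ (suc k) n       =
  concatMap (λ m → map (replicate m (suc k) ++_) (partitions≤ k (n ∸ m * suc k)))
            (upTo (suc (n / suc k)))

-- By partitions-sound, partitions-complete and partitions-unique below, this
-- lists every partition of n exactly once.
partitions : ℕ → List (List ℕ)
partitions n = partitions≤ n n

OddPartsDistinct EvenPartsDistinct : Pred (List ℕ) _
OddPartsDistinct  xs = Unique (filter odd? xs)
EvenPartsDistinct xs = Unique (filter even? xs)

oddPartsDistinct? : Decidable OddPartsDistinct
oddPartsDistinct? xs = unique? (filter odd? xs)

evenPartsDistinct? : Decidable EvenPartsDistinct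
evenPartsDistinct? xs = unique? (filter even? xs)

pod : ℕ → ℕ
pod n = length (filter oddPartsDistinct? (partitions n))

ped : ℤ → ℕ
ped (+ n)    = length (filter evenPartsDistinct? (partitions n))
ped -[1+ _ ] = 0

partialSum : {P : Pred ℕ p} → Decidable P → (ℕ → ℤ) → ℕ → ℤ
partialSum P? f N = foldr ℤ._+_ 0ℤ (map f (filter P? (upTo N)))

-- The infinite sum of f j over all j ≥ 0 satisfying P has only finitely many
-- nonzero terms and equals s.  In ℤ this says exactly that its partial sums
-- are eventually constant with value s.
HasSum : {P : Pred ℕ p} → Decidable P → (ℕ → ℤ) → ℤ → Set
HasSum P? f s = ∃[ N ] ∀ M → N ≤ M → partialSum P? f M ≡ s

private
  block : (k n m : ℕ) → List (List ℕ)
  block k n m = map (replicate m (suc k) ++_) (partitions≤ k (n ∸ m * suc k))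

  multiple≤ : ∀ {m n} k → m < suc (n / suc k) → m * suc k ≤ n
  multiple≤ {m} {n} k (s≤s m≤) = ≤-trans (*-monoˡ-≤ (suc k) m≤) (m/n*n≤m n (suc k))

  sum-replicate : ∀ m k → sum (replicate m k) ≡ m * k
  sum-replicate zero    k = refl
  sum-replicate (suc m) k = cong (λ s → k + s) (sum-replicate m k)

  replicate-≥ : ∀ m k → AllPairs _≥_ (replicate m k)
  replicate-≥ zero    k = []
  replicate-≥ (suc m) k = All.replicate⁺ m ≤-refl ∷ replicate-≥ m k

  Bounded : ℕ → ℕ → List ℕ → Set
  Bounded k n xs = All (_≤ k) xs × AllPairs _≥_ xs × All (0 <_) xs × sum xs ≡ n

  sound≤ : ∀ k n {xs} → xs ∈ partitions≤ k n → Bounded k n xs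
  sound≤ zero    zero (here refl) = [] , [] , [] , refl
  sound≤ (suc k) n    xs∈
    with _ , xs∈yss , yss∈ ← ∈-concat⁻′ (map (block k n) (upTo (suc (n / suc k)))) xs∈
    with m , m∈ , refl ← ∈-map⁻ (block k n) yss∈
    with ys , ys∈ , refl ← ∈-map⁻ (replicate m (suc k) ++_) xs∈yss
    with ys≤k , ys≥ , ys>0 , Σys ← sound≤ k _ ys∈
    = All.++⁺ (All.replicate⁺ m ≤-refl) (All.map m≤n⇒m≤1+n ys≤k)
    , AllPairs.++⁺ (replicate-≥ m (suc k)) ys≥
        (All.replicate⁺ m (All.map m≤n⇒m≤1+n ys≤k))
    , All.++⁺ (All.replicate⁺ m z<s) ys>0
    , (begin
        sum (replicate m (suc k) ++ ys)     ≡⟨ sum-++ (replicate m (suc k)) ys ⟩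
        sum (replicate m (suc k)) + sum ys  ≡⟨ cong₂ _+_ (sum-replicate m (suc k)) Σys ⟩
        m * suc k + (n ∸ m * suc k)         ≡⟨ m+[n∸m]≡n (multiple≤ k (∈-upTo⁻ m∈)) ⟩
        n                                   ∎)
    where open ≡-Reasoning

  split : ∀ k {xs} → All (_≤ suc k) xs → AllPairs _≥_ xs →
          ∃[ m ] ∃[ ys ] xs ≡ replicate m (suc k) ++ ys × All (_≤ k) ys
  split k [] [] = 0 , [] , refl , []
  split k {x ∷ xs} (x≤ ∷ xs≤) (x≥xs ∷ xs≥) with x ≟ suc k
  ... | yes refl with m , ys , refl , ys≤ ← split k xs≤ xs≥ = suc m , ys , refl , ys≤
  ... | no x≢ = 0 , x ∷ xs , refl , x≤k ∷ All.map (λ y≤x → ≤-trans y≤x x≤k) x≥xs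
    where x≤k = s≤s⁻¹ (≤∧≢⇒< x≤ x≢)

  AllPairs-++⁻ʳ : ∀ xs {ys : List ℕ} → AllPairs _≥_ (xs ++ ys) → AllPairs _≥_ ys
  AllPairs-++⁻ʳ []       pys       = pys
  AllPairs-++⁻ʳ (_ ∷ xs) (_ ∷ pys) = AllPairs-++⁻ʳ xs pys

  complete≤ : ∀ k n {xs} → Bounded k n xs → xs ∈ partitions≤ k n
  complete≤ zero    _ {[]}    (_ , _ , _ , refl) = here refl
  complete≤ zero    n {x ∷ _} (x≤0 ∷ _ , _ , x>0 ∷ _ , _) = ⊥-elim (<⇒≱ x>0 x≤0)
  complete≤ (suc k) n (xs≤ , xs≥ , xs>0 , Σxs)
    with m , ys , refl , ys≤ ← split k xs≤ xs≥
    = ∈-concat⁺′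
        (∈-map⁺ (replicate m (suc k) ++_)
          (complete≤ k _ ( ys≤
                         , AllPairs-++⁻ʳ (replicate m (suc k)) xs≥
                         , All.++⁻ʳ (replicate m (suc k)) xs>0
                         , Σys)))
        (∈-map⁺ (block k n) (∈-upTo⁺ (s≤s m≤)))
    where
    Σ≡ : m * suc k + sum ys ≡ n
    Σ≡ = trans (cong (_+ sum ys) (sym (sum-replicate m (suc k))))
               (trans (sym (sum-++ (replicate m (suc k)) ys)) Σxs)
    Σys : sum ys ≡ n ∸ m * suc k
    Σys = trans (sym (m+n∸m≡n (m * suc k) (sum ys))) (cong (_∸ m * suc k) Σ≡)
    m≤ : m ≤ n / suc k
    m≤ = subst (_≤ n / suc k) (m*n/n≡m m (suc k))
           (/-monoˡ-≤ (suc k) (m+n≤o⇒m≤o (m * suc k) (≤-reflexive Σ≡)))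

  multiplicity-unique : ∀ k m m′ {ys ys′} → All (_≤ k) ys → All (_≤ k) ys′ →
    replicate m (suc k) ++ ys ≡ replicate m′ (suc k) ++ ys′ → m ≡ m′
  multiplicity-unique k zero    zero     _          _          _    = refl
  multiplicity-unique k zero    (suc _)  (sk≤k ∷ _) _          refl = ⊥-elim (1+n≰n sk≤k)
  multiplicity-unique k (suc _) zero     _          (sk≤k ∷ _) refl = ⊥-elim (1+n≰n sk≤k)
  multiplicity-unique k (suc m) (suc m′) ys≤        ys′≤       eq   =
    cong suc (multiplicity-unique k m m′ ys≤ ys′≤ (∷-injectiveʳ eq))

  unique≤ : ∀ k n → Unique (partitions≤ k n)
  unique≤ zero    zero    = [] ∷ []
  unique≤ zero    (suc _) = []
  unique≤ (suc k) n       = Unique.concat⁺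
    (All.map⁺ (All.universal
      (λ m → Unique.map⁺ (++-cancelˡ (replicate m (suc k)) _ _) (unique≤ k (n ∸ m * suc k)))
      (upTo (suc (n / suc k)))))
    (AllPairs.map⁺ (AllPairs.map disjoint (Unique.upTo⁺ (suc (n / suc k)))))
    where
    disjoint : ∀ {m m′} → m ≢ m′ → Disjoint (block k n m) (block k n m′)
    disjoint {m} {m′} m≢m′ (p , q)
      with _ , ys∈  , refl ← ∈-map⁻ (replicate m  (suc k) ++_) p
      with _ , ys′∈ , eq   ← ∈-map⁻ (replicate m′ (suc k) ++_) q
      with ys≤  , _ ← sound≤ k _ ys∈
      with ys′≤ , _ ← sound≤ k _ ys′∈
      = m≢m′ (multiplicity-unique k m m′ ys≤ ys′≤ eq)

  parts≤sum : ∀ xs → All (_≤ sum xs) xs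
  parts≤sum []       = []
  parts≤sum (x ∷ xs) = m≤m+n x (sum xs) ∷ All.map (m≤n⇒m≤o+n x) (parts≤sum xs)

partitions-sound : ∀ n {xs} → xs ∈ partitions n → xs PartitionOf n
partitions-sound n xs∈ with _ , xs≥ , xs>0 , Σxs ← sound≤ n n xs∈ = record
  { nonincreasing = AllPairs⇒Linked xs≥
  ; positive      = xs>0
  ; total         = Σxs
  }

partitions-complete : ∀ n {xs} → xs PartitionOf n → xs ∈ partitions n
partitions-complete n {xs} xs⊢n = complete≤ n n
  ( subst (λ s → All (_≤ s) xs) total (parts≤sum xs)
  , Linked⇒AllPairs (λ x≥y y≥z → ≤-trans y≥z x≥y) nonincreasing
  , positive
  , total )
  where open _PartitionOf_ xs⊢n

partitions-unique : ∀ n → Unique (partitions n)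
partitions-unique n = unique≤ n n

{-# OPTIONS --safe #-}
module Submission where

open import Data.Integer using (+_; -1ℤ; _-_; _*_; _^_)
open import Data.Nat using (ℕ)
open import Data.Nat.DivMod using (_/_)
open import Defs

-- In generating functions the theorem says POD(q) = POD(−q²) PED(q), where
--   POD(q) = ∏_{s odd} (1 + qˢ) ∏_{s even} 1 / (1 − qˢ)
--   PED(q) = ∏_{s even} (1 + qˢ) ∏_{s odd} 1 / (1 − qˢ).
-- The identity already holds factor by factor in s, because
--   1 + qˢ = (1 − q²ˢ) / (1 − qˢ)        for s odd,
--   1 / (1 − qˢ) = (1 + qˢ) / (1 − q²ˢ)  for s even.
-- Hence it holds, by induction on k, for the partitions with all parts ≤ k, and
-- the coefficient of qⁿ is already the right one for k = n.

open import Data.Integer as ℤ using (ℤ; -[1+_]; 0ℤ; 1ℤ; _⊖_; -_; _+_)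
import Data.Integer.Properties as ℤ
open import Data.Integer.Tactic.RingSolver using (solve-∀)
open import Data.List.Base
  using (List; []; _∷_; _++_; map; filter; foldr; length; replicate; concatMap; upTo; applyUpTo)
open import Data.List.Properties
  using (map-id; map-∘; map-++; map-upTo; map-concatMap; concatMap-map; concatMap-cong; ++-identityʳ;
         filter-++; length-++; filter-none; filter-accept; filter-reject)
open import Data.List.Relation.Unary.All as All using (All; []; _∷_)
import Data.List.Relation.Unary.All.Properties as All
open import Data.List.Relation.Unary.AllPairs using (_∷_)
open import Data.List.Relation.Unary.Unique.Propositional using (Unique)
open import Data.Nat as ℕ using (zero; suc; _∸_; _≤_; _<_; z≤n; s≤s)
open import Data.Nat.Divisibility using (_∣0; ∣-refl; ∣m∣n⇒∣m+n; ∣m+n∣m⇒∣n)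
open import Data.Nat.DivMod using (m<n⇒m/n≡0; n/n≡1; +-distrib-/-∣ˡ)
open import Data.Nat.Induction using (<-rec)
import Data.Nat.Properties as ℕ
open import Data.List.Relation.Unary.Unique.DecPropositional ℕ._≟_ using (unique?)
open import Data.Product using (_,_)
open import Data.Sum using (inj₁; inj₂)
open import Function using (_∘_; _⇔_; mk⇔; Equivalence)
open import Level using (Level)
open import Relation.Binary.PropositionalEquality
open import Relation.Nullary using (¬_; yes; no; contradiction)
open import Relation.Nullary.Decidable using (toWitnessFalse)
open import Relation.Unary using (Pred; Decidable)

open ≡-Reasoning

private
  variable
    a p q : Level
    A B : Set a
    P : Pred A p
    Q : Pred B q
    k n : ℕ

-- Lists of partitions with bounded parts, split by the largest allowed part.

length-filter-map : (P? : Decidable P) (Q? : Decidable Q) (f : A → B) {xs : List A} →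
  All (λ x → Q (f x) ⇔ P x) xs →
  length (filter Q? (map f xs)) ≡ length (filter P? xs)
length-filter-map P? Q? f []                = refl
length-filter-map P? Q? f {x ∷ _} (eq ∷ eqs) with P? x | Q? (f x)
... | yes _  | yes _  = cong suc (length-filter-map P? Q? f eqs)
... | no _   | no _   = length-filter-map P? Q? f eqs
... | yes px | no ¬qx = contradiction (Equivalence.from eq px) ¬qx
... | no ¬px | yes qx = contradiction (Equivalence.to eq qx) ¬px

partitions≤-bounded : ∀ k n → All (All (_≤ k)) (partitions≤ k n)
partitions≤-bounded zero    zero    = [] ∷ []
partitions≤-bounded zero    (suc n) = []
partitions≤-bounded (suc k) n       = All.concat⁺ (All.map⁺ (All.universal
  (λ m → All.map⁺ (All.map (λ xs≤k → All.++⁺ (All.replicate⁺ m ℕ.≤-refl) (All.map ℕ.m≤n⇒m≤1+n xs≤k))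
                           (partitions≤-bounded k (n ∸ m ℕ.* suc k))))
  (upTo (suc (n / suc k)))))

partitions≤-< : n < suc k → partitions≤ (suc k) n ≡ partitions≤ k n
partitions≤-< {n} {k} n<s rewrite m<n⇒m/n≡0 n<s =
  trans (++-identityʳ _) (map-id (partitions≤ k n))

-- Multiplicity 0 of `suc k` gives the first list. Since `(suc k + r) / suc k` is `1 + r / suc k`,
-- the positive multiplicities are the successors of those occurring for `r`, and one copy of
-- `suc k` can be taken out of each block.
partitions≤-+ : ∀ k r → partitions≤ (suc k) (suc k ℕ.+ r) ≡
  partitions≤ k (suc k ℕ.+ r) ++ map (suc k ∷_) (partitions≤ (suc k) r)
partitions≤-+ k r = begin
  concatMap (block (s ℕ.+ r)) (upTo (suc ((s ℕ.+ r) / s)))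
    ≡⟨ cong (λ d → concatMap (block (s ℕ.+ r)) (upTo (suc d)))
            (trans (+-distrib-/-∣ˡ r (∣-refl {s})) (cong (ℕ._+ r / s) (n/n≡1 s))) ⟩
  map (λ xs → xs) (partitions≤ k (s ℕ.+ r)) ++ concatMap (block (s ℕ.+ r)) (applyUpTo suc (suc (r / s)))
    ≡⟨ cong₂ (λ xss ms → xss ++ concatMap (block (s ℕ.+ r)) ms)
             (map-id (partitions≤ k (s ℕ.+ r))) (sym (map-upTo suc (suc (r / s)))) ⟩
  partitions≤ k (s ℕ.+ r) ++ concatMap (block (s ℕ.+ r)) (map suc (upTo (suc (r / s))))
    ≡⟨ cong (partitions≤ k (s ℕ.+ r) ++_) (concatMap-map (block (s ℕ.+ r)) suc (upTo (suc (r / s)))) ⟩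
  partitions≤ k (s ℕ.+ r) ++ concatMap (block (s ℕ.+ r) ∘ suc) (upTo (suc (r / s)))
    ≡⟨ cong (partitions≤ k (s ℕ.+ r) ++_) (concatMap-cong block-suc (upTo (suc (r / s)))) ⟩
  partitions≤ k (s ℕ.+ r) ++ concatMap (map (s ∷_) ∘ block r) (upTo (suc (r / s)))
    ≡⟨ cong (partitions≤ k (s ℕ.+ r) ++_) (map-concatMap (s ∷_) (block r) (upTo (suc (r / s)))) ⟨
  partitions≤ k (s ℕ.+ r) ++ map (s ∷_) (partitions≤ s r) ∎
  where
  s = suc k
  block : ℕ → ℕ → List (List ℕ)
  block n m = map (replicate m s ++_) (partitions≤ k (n ∸ m ℕ.* s))
  block-suc : ∀ m → block (s ℕ.+ r) (suc m) ≡ map (s ∷_) (block r m)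
  block-suc m = trans
    (cong (map (replicate (suc m) s ++_) ∘ partitions≤ k) (ℕ.[m+n]∸[m+o]≡n∸o s r (m ℕ.* s)))
    (map-∘ (partitions≤ k (r ∸ m ℕ.* s)))

-- Counting partitions in which the parts satisfying `Q` are distinct.

module _ {Q : Pred ℕ q} (Q? : Decidable Q) where

  -- For `odd?` and `even?` this is `oddPartsDistinct?` and `evenPartsDistinct?`, so `pod n` and
  -- `ped (+ n)` are `count odd? n n` and `count even? n n` by definition.
  distinct? : Decidable (Unique ∘ filter Q?)
  distinct? xs = unique? (filter Q? xs)

  count : ℕ → ℕ → ℕ
  count k n = length (filter distinct? (partitions≤ k n))

  count-< : n < suc k → count (suc k) n ≡ count k n
  count-< n<s = cong (length ∘ filter distinct?) (partitions≤-< n<s)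

  -- A part larger than `n` cannot occur in a partition of `n`. Hence a single bound on the parts
  -- serves all coefficients up to that bound.
  count-stable : n ≤ k → count k n ≡ count n n
  count-stable {n} {k} n≤k with ℕ.m≤n⇒m<n∨m≡n n≤k
  ... | inj₂ refl = refl
  count-stable {n} {suc k} _ | inj₁ n<s = trans (count-< n<s) (count-stable (ℕ.s≤s⁻¹ n<s))

  private
    count-+ : ∀ k r → count (suc k) (suc k ℕ.+ r) ≡
      count k (suc k ℕ.+ r) ℕ.+ length (filter distinct? (map (suc k ∷_) (partitions≤ (suc k) r)))
    count-+ k r = begin
      length (filter distinct? (partitions≤ (suc k) (suc k ℕ.+ r)))
        ≡⟨ cong (length ∘ filter distinct?) (partitions≤-+ k r) ⟩
      length (filter distinct? (xss ++ yss))
        ≡⟨ cong length (filter-++ distinct? xss yss) ⟩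
      length (filter distinct? xss ++ filter distinct? yss)
        ≡⟨ length-++ (filter distinct? xss) ⟩
      count k (suc k ℕ.+ r) ℕ.+ length (filter distinct? yss) ∎
      where
      xss = partitions≤ k (suc k ℕ.+ r)
      yss = map (suc k ∷_) (partitions≤ (suc k) r)

  -- The filter for `Q` drops `suc k`, so prefixing one more copy does not affect distinctness.
  count-repeatable : ¬ Q (suc k) → ∀ r →
    count (suc k) (suc k ℕ.+ r) ≡ count k (suc k ℕ.+ r) ℕ.+ count (suc k) r
  count-repeatable {k} ¬Qs r = trans (count-+ k r) (cong (count k (suc k ℕ.+ r) ℕ.+_)
    (length-filter-map distinct? distinct? (suc k ∷_) (All.universal
      (λ _ → mk⇔ (subst Unique (filter-reject Q? ¬Qs)) (subst Unique (sym (filter-reject Q? ¬Qs))))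
      (partitions≤ (suc k) r))))

  -- A part in `Q` occurs at most once, so after one copy of `suc k` the remaining parts are at most
  -- `k`.
  count-distinct : Q (suc k) → ∀ r →
    count (suc k) (suc k ℕ.+ r) ≡ count k (suc k ℕ.+ r) ℕ.+ count k r
  count-distinct {k} Qs r = trans (count-+ k r) (cong (count k (suc k ℕ.+ r) ℕ.+_) (with-largest r))
    where
    s = suc k

    once : ∀ r → length (filter distinct? (map (s ∷_) (partitions≤ k r))) ≡ count k r
    once r = length-filter-map distinct? distinct? (s ∷_) (All.map
      (λ xs≤k → mk⇔
        (λ u → tail (subst Unique (filter-accept Q? Qs) u))
        (λ u → subst Unique (sym (filter-accept Q? Qs))
                 -- The other parts are at most `k`, so none of them equals `s`.
                 (All.filter⁺ Q? (All.map (λ x≤k s≡x → ℕ.1+n≰n (subst (_≤ k) (sym s≡x) x≤k)) xs≤k) ∷ u)))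
      (partitions≤-bounded k r))
      where
      tail : ∀ {x xs} → Unique {A = ℕ} (x ∷ xs) → Unique xs
      tail (_ ∷ u) = u

    twice : ∀ xss → filter distinct? (map (s ∷_) (map (s ∷_) xss)) ≡ []
    twice xss = filter-none distinct? (All.map⁺ (All.map⁺ (All.universal ¬distinct xss)))
      where
      ¬distinct : ∀ xs → ¬ Unique (filter Q? (s ∷ s ∷ xs))
      ¬distinct xs u with subst Unique (trans (filter-accept Q? Qs) (cong (s ∷_) (filter-accept Q? Qs))) u
      ... | (s≢s ∷ _) ∷ _ = s≢s refl

    with-largest : ∀ r → length (filter distinct? (map (s ∷_) (partitions≤ s r))) ≡ count k r
    with-largest r with ℕ.<-≤-connex r s
    ... | inj₁ r<s = trans (cong (length ∘ filter distinct? ∘ map (s ∷_)) (partitions≤-< r<s)) (once r)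
    -- Splitting `r` once more isolates the lists that would contain `s` twice; `twice` discards
    -- them.
    ... | inj₂ s≤r with t , refl ← ℕ.m≤n⇒∃[o]m+o≡n s≤r = begin
      length (filter distinct? (map (s ∷_) (partitions≤ s (s ℕ.+ t))))
        ≡⟨ cong (length ∘ filter distinct? ∘ map (s ∷_)) (partitions≤-+ k t) ⟩
      length (filter distinct? (map (s ∷_) (xss ++ map (s ∷_) yss)))
        ≡⟨ cong (length ∘ filter distinct?) (map-++ (s ∷_) xss _) ⟩
      length (filter distinct? (map (s ∷_) xss ++ map (s ∷_) (map (s ∷_) yss)))
        ≡⟨ cong length (filter-++ distinct? (map (s ∷_) xss) _) ⟩
      length (filter distinct? (map (s ∷_) xss) ++ filter distinct? (map (s ∷_) (map (s ∷_) yss)))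
        ≡⟨ cong (λ zss → length (filter distinct? (map (s ∷_) xss) ++ zss)) (twice yss) ⟩
      length (filter distinct? (map (s ∷_) xss) ++ [])
        ≡⟨ cong length (++-identityʳ (filter distinct? (map (s ∷_) xss))) ⟩
      length (filter distinct? (map (s ∷_) xss))
        ≡⟨ once (s ℕ.+ t) ⟩
      count k (s ℕ.+ t) ∎
      where
      xss = partitions≤ k (s ℕ.+ t)
      yss = partitions≤ s t

-- Formal power series in q and the algebra of the product f(q²) g(q).

Series : Set
Series = ℕ → ℤ

private
  variable
    e e′ f f′ g h : Series

infixl 6 _⊕_
infix  8 ⊝_

_⊕_ : Series → Series → Series
(f ⊕ g) n = f n + g n

⊝_ : Series → Series
(⊝ f) n = - f n

shift : Series → Series
shift f zero    = 0ℤ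
shift f (suc n) = f n

delay : ℕ → Series → Series
delay zero    f = f
delay (suc s) f = shift (delay s f)

-- The substitution f(-q); as left factor of `_⊛_` it becomes f(-q²).
alternate : Series → Series
alternate f n = -1ℤ ^ n * f n

-- The coefficients of f(q²) g(q).
infixl 7 _⊛_
_⊛_ : Series → Series → Series
(f ⊛ g) zero          = f 0 * g 0
(f ⊛ g) (suc zero)    = f 0 * g 1
(f ⊛ g) (suc (suc n)) = f 0 * g (suc (suc n)) + (f ∘ suc ⊛ g) n

shift-cong : f ≗ g → shift f ≗ shift g
shift-cong f≗g zero    = refl
shift-cong f≗g (suc n) = f≗g n

shift-⊕ : ∀ f g → shift (f ⊕ g) ≗ shift f ⊕ shift g
shift-⊕ f g zero    = refl
shift-⊕ f g (suc n) = refl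

delay-cong : ∀ s → f ≗ g → delay s f ≗ delay s g
delay-cong zero    f≗g = f≗g
delay-cong (suc s) f≗g = shift-cong (delay-cong s f≗g)

delay-⊕ : ∀ s f g → delay s (f ⊕ g) ≗ delay s f ⊕ delay s g
delay-⊕ zero    f g n = refl
delay-⊕ (suc s) f g n = trans (shift-cong (delay-⊕ s f g) n) (shift-⊕ (delay s f) (delay s g) n)

delay-shift : ∀ s f → delay s (shift f) ≗ shift (delay s f)
delay-shift zero    f n = refl
delay-shift (suc s) f   = shift-cong (delay-shift s f)

delay-< : ∀ {s} f → n < s → delay s f n ≡ 0ℤ
delay-< {n = zero}  {s = suc s} f _         = refl
delay-< {n = suc n} {s = suc s} f (s≤s n<s) = delay-< f n<s

delay-+ : ∀ s f n → delay s f (s ℕ.+ n) ≡ f n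
delay-+ zero    f n = refl
delay-+ (suc s) f n = delay-+ s f n

-- Assembles a recurrence for the coefficients, known separately below and from index `s`, into one
-- identity f = g + qˢ h.
delay-ext : ∀ s → (∀ {n} → n < s → f n ≡ g n) → (∀ r → f (s ℕ.+ r) ≡ g (s ℕ.+ r) + h r) →
  f ≗ g ⊕ delay s h
delay-ext {f} {g} {h} s below above n with ℕ.<-≤-connex n s
... | inj₁ n<s = begin
  f n               ≡⟨ below n<s ⟩
  g n               ≡⟨ ℤ.+-identityʳ (g n) ⟨
  g n + 0ℤ          ≡⟨ cong (λ z → g n + z) (delay-< h n<s) ⟨
  g n + delay s h n ∎
... | inj₂ s≤n with r , refl ← ℕ.m≤n⇒∃[o]m+o≡n s≤n =
  trans (above r) (cong (λ z → g (s ℕ.+ r) + z) (sym (delay-+ s h r)))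

-- This stands in for division by 1 - qˢ⁺¹. The exponent is positive, so each coefficient is
-- determined by `h` and a strictly earlier coefficient.
delay-fixpoint-unique : ∀ s h → f ≗ h ⊕ delay (suc s) f → g ≗ h ⊕ delay (suc s) g → f ≗ g
delay-fixpoint-unique {f} {g} s h f-fix g-fix = <-rec (λ n → f n ≡ g n) step
  where
  step : ∀ n → (∀ {m} → m < n → f m ≡ g m) → f n ≡ g n
  step n ih = trans (f-fix n) (trans (cong (λ z → h n + z) delayed) (sym (g-fix n)))
    where
    delayed : delay (suc s) f n ≡ delay (suc s) g n
    delayed with ℕ.<-≤-connex n (suc s)
    ... | inj₁ n<s = trans (delay-< f n<s) (sym (delay-< g n<s))
    ... | inj₂ s≤n with r , refl ← ℕ.m≤n⇒∃[o]m+o≡n s≤n = begin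
      delay (suc s) f (suc s ℕ.+ r) ≡⟨ delay-+ (suc s) f r ⟩
      f r                           ≡⟨ ih (s≤s (ℕ.m≤n+m r s)) ⟩
      g r                           ≡⟨ delay-+ (suc s) g r ⟨
      delay (suc s) g (suc s ℕ.+ r) ∎

-- Coefficient `n` of the product involves only coefficients up to `n`. The bounded form matters
-- because `pod` and `ped` agree with the counts for a fixed bound on the parts only up to that
-- bound.
⊛-cong-≤ : ∀ f f′ {g g′} n → (∀ {i} → i ≤ n → f i ≡ f′ i) → (∀ {i} → i ≤ n → g i ≡ g′ i) →
  (f ⊛ g) n ≡ (f′ ⊛ g′) n
⊛-cong-≤ f f′ zero          f≡ g≡ = cong₂ _*_ (f≡ z≤n) (g≡ z≤n)
⊛-cong-≤ f f′ (suc zero)    f≡ g≡ = cong₂ _*_ (f≡ z≤n) (g≡ ℕ.≤-refl)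
⊛-cong-≤ f f′ (suc (suc n)) f≡ g≡ = cong₂ _+_ (cong₂ _*_ (f≡ z≤n) (g≡ ℕ.≤-refl))
  (⊛-cong-≤ (f ∘ suc) (f′ ∘ suc) n
    (λ i≤n → f≡ (s≤s (ℕ.m≤n⇒m≤1+n i≤n))) (λ i≤n → g≡ (ℕ.m≤n⇒m≤1+n (ℕ.m≤n⇒m≤1+n i≤n))))

⊛-cong : ∀ {g′} → f ≗ f′ → g ≗ g′ → f ⊛ g ≗ f′ ⊛ g′
⊛-cong {f} {f′} f≗f′ g≗g′ n = ⊛-cong-≤ f f′ n (λ {i} _ → f≗f′ i) (λ {i} _ → g≗g′ i)

⊛-zeroˡ : ∀ g → (λ _ → 0ℤ) ⊛ g ≗ (λ _ → 0ℤ)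
⊛-zeroˡ g zero          = refl
⊛-zeroˡ g (suc zero)    = refl
⊛-zeroˡ g (suc (suc n)) = trans (ℤ.+-identityˡ _) (⊛-zeroˡ g n)

⊛-distribʳ-⊕ : ∀ f f′ g → (f ⊕ f′) ⊛ g ≗ f ⊛ g ⊕ f′ ⊛ g
⊛-distribʳ-⊕ f f′ g zero          = ℤ.*-distribʳ-+ (g 0) (f 0) (f′ 0)
⊛-distribʳ-⊕ f f′ g (suc zero)    = ℤ.*-distribʳ-+ (g 1) (f 0) (f′ 0)
⊛-distribʳ-⊕ f f′ g (suc (suc n)) =
  trans (cong (λ z → (f 0 + f′ 0) * g (suc (suc n)) + z) (⊛-distribʳ-⊕ (f ∘ suc) (f′ ∘ suc) g n))
        (rearrange (f 0) (f′ 0) (g (suc (suc n))) _ _)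
  where
  rearrange : ∀ x y z u v → (x + y) * z + (u + v) ≡ (x * z + u) + (y * z + v)
  rearrange = solve-∀

⊛-distribˡ-⊕ : ∀ f g h → f ⊛ (g ⊕ h) ≗ f ⊛ g ⊕ f ⊛ h
⊛-distribˡ-⊕ f g h zero          = ℤ.*-distribˡ-+ (f 0) (g 0) (h 0)
⊛-distribˡ-⊕ f g h (suc zero)    = ℤ.*-distribˡ-+ (f 0) (g 1) (h 1)
⊛-distribˡ-⊕ f g h (suc (suc n)) =
  trans (cong (λ z → f 0 * (g (suc (suc n)) + h (suc (suc n))) + z) (⊛-distribˡ-⊕ (f ∘ suc) g h n))
        (rearrange (f 0) (g (suc (suc n))) (h (suc (suc n))) _ _)
  where
  rearrange : ∀ x y z u v → x * (y + z) + (u + v) ≡ (x * y + u) + (x * z + v)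
  rearrange = solve-∀

⊛-⊝ˡ : ∀ f g → ⊝ f ⊛ g ≗ ⊝ (f ⊛ g)
⊛-⊝ˡ f g zero          = sym (ℤ.neg-distribˡ-* (f 0) (g 0))
⊛-⊝ˡ f g (suc zero)    = sym (ℤ.neg-distribˡ-* (f 0) (g 1))
⊛-⊝ˡ f g (suc (suc n)) =
  trans (cong (λ z → - f 0 * g (suc (suc n)) + z) (⊛-⊝ˡ (f ∘ suc) g n))
        (rearrange (f 0) (g (suc (suc n))) _)
  where
  rearrange : ∀ x y u → - x * y + - u ≡ - (x * y + u)
  rearrange = solve-∀

⊛-shiftʳ : ∀ f g → f ⊛ shift g ≗ shift (f ⊛ g)
⊛-shiftʳ f g zero                = ℤ.*-zeroʳ (f 0)
⊛-shiftʳ f g (suc zero)          = refl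
⊛-shiftʳ f g (suc (suc zero))    =
  trans (cong (λ z → f 0 * g 1 + z) (ℤ.*-zeroʳ (f 1))) (ℤ.+-identityʳ (f 0 * g 1))
⊛-shiftʳ f g (suc (suc (suc n))) =
  cong (λ z → f 0 * g (suc (suc n)) + z) (⊛-shiftʳ (f ∘ suc) g (suc n))

⊛-shiftˡ : ∀ f g → shift f ⊛ g ≗ shift (shift (f ⊛ g))
⊛-shiftˡ f g zero          = refl
⊛-shiftˡ f g (suc zero)    = refl
⊛-shiftˡ f g (suc (suc n)) = ℤ.+-identityˡ ((f ⊛ g) n)

⊛-delayʳ : ∀ s f g → f ⊛ delay s g ≗ delay s (f ⊛ g)
⊛-delayʳ zero    f g n = refl
⊛-delayʳ (suc s) f g n = trans (⊛-shiftʳ f (delay s g) n) (shift-cong (⊛-delayʳ s f g) n)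

-- The left factor is taken at q², so its qˢ contributes q²ˢ, written as two delays by `s`.
⊛-delayˡ : ∀ s f g → delay s f ⊛ g ≗ delay s (delay s (f ⊛ g))
⊛-delayˡ zero    f g n = refl
⊛-delayˡ (suc s) f g n = begin
  (shift (delay s f) ⊛ g) n                   ≡⟨ ⊛-shiftˡ (delay s f) g n ⟩
  shift (shift (delay s f ⊛ g)) n             ≡⟨ shift-cong (shift-cong (⊛-delayˡ s f g)) n ⟩
  shift (shift (delay s (delay s (f ⊛ g)))) n ≡⟨ shift-cong (delay-shift s (delay s (f ⊛ g))) n ⟨
  shift (delay s (shift (delay s (f ⊛ g)))) n ∎

-- delay s is multiplication by qˢ, so f′ = (1 − qˢ) f and e′ = e / (1 − qˢ).
⊛-odd-factor : ∀ s → f′ ≗ f ⊕ ⊝ delay s f → e′ ≗ e ⊕ delay s e′ → f ⊛ e ≗ h →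
  f′ ⊛ e′ ≗ h ⊕ delay s h
⊛-odd-factor {f′} {f} {e′} {e} {h} s f′≗ e′≗ fe≗h n = begin
  (f′ ⊛ e′) n                            ≡⟨ ⊛-cong f′≗ (λ _ → refl) n ⟩
  ((f ⊕ ⊝ delay s f) ⊛ e′) n             ≡⟨ ⊛-distribʳ-⊕ f (⊝ delay s f) e′ n ⟩
  x n + (⊝ delay s f ⊛ e′) n             ≡⟨ cong (λ z → x n + z) (⊛-⊝ˡ (delay s f) e′ n) ⟩
  x n + - (delay s f ⊛ e′) n             ≡⟨ cong (λ z → x n + - z) (⊛-delayˡ s f e′ n) ⟩
  x n + - delay s (delay s x) n          ≡⟨ cong (λ z → z + - delay s (delay s x) n) x≡ ⟩
  h n + (delay s h n + delay s (delay s x) n) + - delay s (delay s x) n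
                                         ≡⟨ cancel (h n) (delay s h n) (delay s (delay s x) n) ⟩
  h n + delay s h n                      ∎
  where
  x : Series
  x = f ⊛ e′
  -- That is, x = h / (1 - qˢ).
  x-fix : x ≗ h ⊕ delay s x
  x-fix n = begin
    (f ⊛ e′) n                     ≡⟨ ⊛-cong {f} (λ _ → refl) e′≗ n ⟩
    (f ⊛ (e ⊕ delay s e′)) n       ≡⟨ ⊛-distribˡ-⊕ f e (delay s e′) n ⟩
    (f ⊛ e) n + (f ⊛ delay s e′) n ≡⟨ cong₂ _+_ (fe≗h n) (⊛-delayʳ s f e′ n) ⟩
    h n + delay s x n              ∎
  -- Unfolding the fixed point twice produces the q²ˢ x that cancels against the term coming from
  -- f(q²).
  x≡ : x n ≡ h n + (delay s h n + delay s (delay s x) n)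
  x≡ = trans (x-fix n) (cong (λ z → h n + z) (trans (delay-cong s x-fix n) (delay-⊕ s h (delay s x) n)))
  cancel : ∀ u v w → u + (v + w) + - w ≡ u + v
  cancel = solve-∀

-- Here f′ = f / (1 − qˢ) and e′ = (1 + qˢ) e.
⊛-even-factor : ∀ s → f′ ≗ f ⊕ delay s f′ → e′ ≗ e ⊕ delay s e → f ⊛ e ≗ h →
  f′ ⊛ e′ ≗ h ⊕ delay s (f′ ⊛ e′)
⊛-even-factor {f′} {f} {e′} {e} {h} s f′≗ e′≗ fe≗h n = begin
  (f′ ⊛ e′) n                                   ≡⟨ split n ⟩
  x n + delay s x n                             ≡⟨ cong (λ z → z + delay s x n) (x-fix n) ⟩
  h n + delay s (delay s x) n + delay s x n     ≡⟨ rearrange (h n) (delay s (delay s x) n) (delay s x n) ⟩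
  h n + (delay s x n + delay s (delay s x) n)   ≡⟨ cong (λ z → h n + z) (delay-⊕ s x (delay s x) n) ⟨
  h n + delay s (x ⊕ delay s x) n               ≡⟨ cong (λ z → h n + z) (delay-cong s split n) ⟨
  h n + delay s (f′ ⊛ e′) n                     ∎
  where
  x : Series
  x = f′ ⊛ e
  split : f′ ⊛ e′ ≗ x ⊕ delay s x
  split n = begin
    (f′ ⊛ e′) n                 ≡⟨ ⊛-cong {f′} (λ _ → refl) e′≗ n ⟩
    (f′ ⊛ (e ⊕ delay s e)) n    ≡⟨ ⊛-distribˡ-⊕ f′ e (delay s e) n ⟩
    x n + (f′ ⊛ delay s e) n    ≡⟨ cong (λ z → x n + z) (⊛-delayʳ s f′ e n) ⟩
    x n + delay s x n           ∎
  -- That is, x = h / (1 - q²ˢ). Together with `split` the product is (1 + qˢ) h / (1 - q²ˢ), which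
  -- is h / (1 - qˢ).
  x-fix : x ≗ h ⊕ delay s (delay s x)
  x-fix n = begin
    (f′ ⊛ e) n                      ≡⟨ ⊛-cong f′≗ (λ _ → refl) n ⟩
    ((f ⊕ delay s f′) ⊛ e) n        ≡⟨ ⊛-distribʳ-⊕ f (delay s f′) e n ⟩
    (f ⊛ e) n + (delay s f′ ⊛ e) n  ≡⟨ cong₂ _+_ (fe≗h n) (⊛-delayˡ s f′ e n) ⟩
    h n + delay s (delay s x) n     ∎
  rearrange : ∀ u v w → u + v + w ≡ u + (w + v)
  rearrange = solve-∀

-- Signs under the substitution of -q for q.

alternate-shift : ∀ f → alternate (shift f) ≗ ⊝ shift (alternate f)
alternate-shift f zero    = refl
alternate-shift f (suc n) = rearrange (-1ℤ ^ n) (f n)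
  where
  rearrange : ∀ x y → -1ℤ * x * y ≡ - (x * y)
  rearrange x y = trans (cong (_* y) (ℤ.-1*i≡-i x)) (sym (ℤ.neg-distribˡ-* x y))

-- Substituting -q in qˢ f(q) gives (-1)ˢ qˢ f(-q).
alternate-delay : ∀ s f n → alternate (delay s f) n ≡ -1ℤ ^ s * delay s (alternate f) n
alternate-delay zero    f n       = sym (ℤ.*-identityˡ (alternate f n))
alternate-delay (suc s) f zero    = sym (ℤ.*-zeroʳ (-1ℤ ^ suc s))
alternate-delay (suc s) f (suc n) = begin
  -1ℤ * -1ℤ ^ n * delay s f n                   ≡⟨ ℤ.*-assoc -1ℤ (-1ℤ ^ n) (delay s f n) ⟩
  -1ℤ * (-1ℤ ^ n * delay s f n)                 ≡⟨ cong (-1ℤ *_) (alternate-delay s f n) ⟩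
  -1ℤ * (-1ℤ ^ s * delay s (alternate f) n)     ≡⟨ ℤ.*-assoc -1ℤ (-1ℤ ^ s) _ ⟨
  -1ℤ * -1ℤ ^ s * delay s (alternate f) n       ∎

-1^[2+n]≡-1^n : ∀ n → -1ℤ ^ suc (suc n) ≡ -1ℤ ^ n
-1^[2+n]≡-1^n n = trans (sym (ℤ.*-assoc -1ℤ -1ℤ (-1ℤ ^ n))) (ℤ.*-identityˡ (-1ℤ ^ n))

2+-even : ∀ {n} → Even n → Even (suc (suc n))
2+-even = ∣m∣n⇒∣m+n ∣-refl

1-odd : Odd 1
1-odd = toWitnessFalse {a? = even? 1} _

-1^even : ∀ n → Even n → -1ℤ ^ n ≡ 1ℤ
-1^even zero          _  = refl
-1^even (suc zero)    1e = contradiction 1e 1-odd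
-1^even (suc (suc n)) ev = trans (-1^[2+n]≡-1^n n) (-1^even n (∣m+n∣m⇒∣n ev ∣-refl))

-1^odd : ∀ n → Odd n → -1ℤ ^ n ≡ -1ℤ
-1^odd zero          od = contradiction (2 ∣0) od
-1^odd (suc zero)    _  = refl
-1^odd (suc (suc n)) od = trans (-1^[2+n]≡-1^n n) (-1^odd n (od ∘ 2+-even))

alternate-recurrence : ∀ s g h → f ≗ g ⊕ delay s h → ∀ n →
  alternate f n ≡ alternate g n + -1ℤ ^ s * delay s (alternate h) n
alternate-recurrence {f} s g h f≗ n = begin
  -1ℤ ^ n * f n                               ≡⟨ cong (-1ℤ ^ n *_) (f≗ n) ⟩
  -1ℤ ^ n * (g n + delay s h n)               ≡⟨ ℤ.*-distribˡ-+ (-1ℤ ^ n) (g n) (delay s h n) ⟩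
  alternate g n + alternate (delay s h) n     ≡⟨ cong (λ z → alternate g n + z) (alternate-delay s h n) ⟩
  alternate g n + -1ℤ ^ s * delay s (alternate h) n ∎

-- Generating functions for bounded parts, built one factor at a time.

module _ {Q : Pred ℕ q} (Q? : Decidable Q) where

  countSeries : ℕ → Series
  countSeries k n = + count Q? k n

  -- The factor 1 / (1 - qˢ) with s = k + 1, expressed without division as a fixed-point equation.
  countSeries-repeatable : ¬ Q (suc k) →
    countSeries (suc k) ≗ countSeries k ⊕ delay (suc k) (countSeries (suc k))
  countSeries-repeatable {k} ¬Qs = delay-ext (suc k) (λ n<s → cong +_ (count-< Q? n<s))
    (λ r → trans (cong +_ (count-repeatable Q? ¬Qs r)) (ℤ.pos-+ _ (count Q? (suc k) r)))

  countSeries-distinct : Q (suc k) →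
    countSeries (suc k) ≗ countSeries k ⊕ delay (suc k) (countSeries k)
  countSeries-distinct {k} Qs = delay-ext (suc k) (λ n<s → cong +_ (count-< Q? n<s))
    (λ r → trans (cong +_ (count-distinct Q? Qs r)) (ℤ.pos-+ _ (count Q? k r)))

podSeries pedSeries : ℕ → Series
podSeries = countSeries odd?
pedSeries = countSeries even?

podSeries-factorisation : ∀ k → alternate (podSeries k) ⊛ pedSeries k ≗ podSeries k
podSeries-factorisation zero zero          = refl
podSeries-factorisation zero (suc zero)    = refl
-- With no parts allowed both series are 1, so all later coefficients vanish.
podSeries-factorisation zero (suc (suc n)) =
  trans (ℤ.+-identityˡ _)
    (trans (⊛-cong {g = pedSeries 0} (λ i → ℤ.*-zeroʳ (-1ℤ ^ suc i)) (λ _ → refl) n)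
           (⊛-zeroˡ (pedSeries 0) n))
podSeries-factorisation (suc k) n with even? (suc k)
-- Here 1 + (-q)ˢ = 1 - qˢ, so the left factor gains 1 - q²ˢ and the right one 1 / (1 - qˢ).
... | no odd = trans
  (⊛-odd-factor (suc k) alternating (countSeries-repeatable even? odd) (podSeries-factorisation k) n)
  (sym (countSeries-distinct odd? odd n))
  where
  alternating : alternate (podSeries (suc k)) ≗
    alternate (podSeries k) ⊕ ⊝ delay (suc k) (alternate (podSeries k))
  alternating n = trans
    (alternate-recurrence (suc k) (podSeries k) (podSeries k) (countSeries-distinct odd? odd) n)
    (cong (λ z → alternate (podSeries k) n + z)
      (trans (cong (_* delay (suc k) (alternate (podSeries k)) n) (-1^odd (suc k) odd))
             (ℤ.-1*i≡-i _)))
-- The product and `podSeries (suc k)` solve the same equation X = `podSeries k` + qˢ X with s = k +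
-- 1, hence coincide.
... | yes even = delay-fixpoint-unique k (podSeries k)
  (⊛-even-factor (suc k) alternating (countSeries-distinct even? even) (podSeries-factorisation k))
  (countSeries-repeatable odd? (λ odd → odd even)) n
  where
  alternating : alternate (podSeries (suc k)) ≗
    alternate (podSeries k) ⊕ delay (suc k) (alternate (podSeries (suc k)))
  alternating n = trans
    (alternate-recurrence (suc k) (podSeries k) (podSeries (suc k))
      (countSeries-repeatable odd? (λ odd → odd even)) n)
    (cong (λ z → alternate (podSeries k) n + z)
      (trans (cong (_* delay (suc k) (alternate (podSeries (suc k))) n) (-1^even (suc k) even))
             (ℤ.*-identityˡ _)))

-- The sum over even indices as a coefficient of the product.

evenSum : Series → ℕ → ℤ
evenSum f zero          = 0ℤ
evenSum f (suc zero)    = f 0 + 0ℤ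
-- Steps of two follow the recursion of `_⊛_`, so the two can be compared by one induction.
evenSum f (suc (suc n)) = f 0 + evenSum (f ∘ suc ∘ suc) n

evenSum-cong : ∀ n → f ≗ g → evenSum f n ≡ evenSum g n
evenSum-cong zero          f≗g = refl
evenSum-cong (suc zero)    f≗g = cong (_+ 0ℤ) (f≗g 0)
evenSum-cong (suc (suc n)) f≗g = cong₂ _+_ (f≗g 0) (evenSum-cong n (f≗g ∘ suc ∘ suc))

evenSum-zero : ∀ n → (∀ j → f j ≡ 0ℤ) → evenSum f n ≡ 0ℤ
evenSum-zero zero          f≡0 = refl
evenSum-zero (suc zero)    f≡0 = cong (_+ 0ℤ) (f≡0 0)
evenSum-zero (suc (suc n)) f≡0 = cong₂ _+_ (f≡0 0) (evenSum-zero n (f≡0 ∘ suc ∘ suc))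

partialSum-even : ∀ f M → partialSum even? f M ≡ evenSum f M
partialSum-even f M = go (λ i → i) M (2 ∣0) (λ _ → refl)
  where
  -- The induction needs an arbitrary run of consecutive numbers starting at an even one, since the
  -- tails of `upTo M` start later.
  go : ∀ i M → Even (i 0) → (∀ n → i (suc n) ≡ suc (i n)) →
    foldr _+_ 0ℤ (map f (filter even? (applyUpTo i M))) ≡ evenSum (f ∘ i) M
  go i zero          _  _     = refl
  go i (suc zero)    ev _     = cong (foldr _+_ 0ℤ ∘ map f) (filter-accept even? ev)
  go i (suc (suc M)) ev i-suc = begin
    foldr _+_ 0ℤ (map f (filter even? (i 0 ∷ i 1 ∷ applyUpTo (i ∘ suc ∘ suc) M)))
      ≡⟨ cong (foldr _+_ 0ℤ ∘ map f)
           (trans (filter-accept even? ev) (cong (i 0 ∷_) (filter-reject even? i1-odd))) ⟩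
    f (i 0) + foldr _+_ 0ℤ (map f (filter even? (applyUpTo (i ∘ suc ∘ suc) M)))
      ≡⟨ cong (λ z → f (i 0) + z) (go (i ∘ suc ∘ suc) M i2-even (i-suc ∘ suc ∘ suc)) ⟩
    f (i 0) + evenSum (f ∘ i ∘ suc ∘ suc) M ∎
    where
    i1-odd : Odd (i 1)
    i1-odd 2∣i1 = 1-odd (∣m+n∣m⇒∣n (subst Even (trans (i-suc 0) (ℕ.+-comm 1 (i 0))) 2∣i1) ev)
    i2-even : Even (i 2)
    i2-even = subst Even (sym (trans (i-suc 1) (cong suc (i-suc 0)))) (2+-even ev)

-- The terms with j > n vanish because `g` is 0 at negative integers. Raising `j` by two moves `f`
-- one place and lowers `n` by two, as in `_⊛_`.
evenSum-⊛ : ∀ f (g : ℤ → ℤ) → (∀ i → g -[1+ i ] ≡ 0ℤ) → ∀ n M → n < M →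
  evenSum (λ j → f (j / 2) * g (n ⊖ j)) M ≡ (f ⊛ (g ∘ +_)) n
evenSum-⊛ f g g≡0 zero       (suc zero)    _ = ℤ.+-identityʳ _
evenSum-⊛ f g g≡0 zero       (suc (suc M)) _ = trans
  (cong (λ z → f 0 * g (+ 0) + z) (evenSum-zero M (λ j →
    trans (cong (f (suc (suc j) / 2) *_) (g≡0 (suc j))) (ℤ.*-zeroʳ (f (suc (suc j) / 2))))))
  (ℤ.+-identityʳ _)
evenSum-⊛ f g g≡0 (suc zero) (suc (suc M)) _ = trans
  (cong (λ z → f 0 * g (+ 1) + z) (evenSum-zero M (λ j →
    trans (cong (f (suc (suc j) / 2) *_) (g≡0 j)) (ℤ.*-zeroʳ (f (suc (suc j) / 2))))))
  (ℤ.+-identityʳ _)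
evenSum-⊛ f g g≡0 (suc zero) (suc zero) (s≤s ())
evenSum-⊛ f g g≡0 (suc (suc n)) (suc (suc M)) (s≤s (s≤s n<M)) =
  cong (λ z → f 0 * g (+ suc (suc n)) + z) (trans
    (evenSum-cong M (λ j → cong₂ (λ i m → f i * g m)
      (+-distrib-/-∣ˡ j (∣-refl {2}))
      (trans (ℤ.[1+m]⊖[1+n]≡m⊖n (suc n) (suc j)) (ℤ.[1+m]⊖[1+n]≡m⊖n n j))))
    (evenSum-⊛ (f ∘ suc) g g≡0 n M n<M))

theorem4p1 : (n : ℕ) →
    HasSum even? (λ j → -1ℤ ^ (j / 2) * + pod (j / 2) * + ped (+ n - + j)) (+ pod n)
-- All terms with j > n are 0, so the partial sums are constant from `suc n` on.
theorem4p1 n = suc n , λ M n<M → begin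
  partialSum even? (λ j → -1ℤ ^ (j / 2) * + pod (j / 2) * + ped (+ n - + j)) M
    ≡⟨ partialSum-even (λ j → -1ℤ ^ (j / 2) * + pod (j / 2) * + ped (+ n - + j)) M ⟩
  evenSum (λ j → -1ℤ ^ (j / 2) * + pod (j / 2) * + ped (+ n - + j)) M
    ≡⟨ evenSum-cong M (λ j → cong (λ m → -1ℤ ^ (j / 2) * + pod (j / 2) * + ped m) (ℤ.m-n≡m⊖n n j)) ⟩
  evenSum (λ j → alternate (+_ ∘ pod) (j / 2) * + ped (n ⊖ j)) M
    ≡⟨ evenSum-⊛ (alternate (+_ ∘ pod)) (+_ ∘ ped) (λ _ → refl) n M n<M ⟩
  (alternate (+_ ∘ pod) ⊛ (+_ ∘ ped ∘ +_)) n
    -- The bound on the parts, which varied with the index, is now fixed at `n`.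
    ≡⟨ ⊛-cong-≤ (alternate (+_ ∘ pod)) (alternate (podSeries n)) n
         (λ {i} i≤n → cong (λ c → -1ℤ ^ i * + c) (sym (count-stable odd? i≤n)))
         (λ i≤n → cong +_ (sym (count-stable even? i≤n))) ⟩
  (alternate (podSeries n) ⊛ pedSeries n) n
    ≡⟨ podSeries-factorisation n n ⟩
  + pod n ∎
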